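{- Let $\alpha$ be a countable ordinal with finite big Ramsey degrees. Then the ordinal $\alpha \cdot m$ has finite big Ramsey degrees for every integer $m \ge 1$.
   Context: For a chain (linearly ordered set) $C$ and a finite chain $n=\{0<1<\dots<n-1\}$, let $\mathrm{Emb}(n,C)$ be the set of order embeddings $n \hookrightarrow C$. The big Ramsey degree $T(n,C)$ is the least positive integer $t$ such that for every integer $k \ge 2$ and every coloring $\chi : \mathrm{Emb}(n, C) \to k$ there is a $U \subseteq C$ order-isomorphic to $C$ with $|\chi(\mathrm{Emb}(n, U))| \le t$; if no such $t$ exists, $T(n,C)=\infty$. A chain $C$ has finite big Ramsey degrees if $T(n,C)<\infty$ for all integers $n\ge 1$. Here $\alpha\cdot m$ is ordinal multiplication, i.e. $\alpha+\dots+\alpha$ ($m$ times). -}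

module Defs where

open import Level using (0ℓ)
open import Data.Nat using (ℕ; _≤_)
open import Data.Fin using (Fin) renaming (_<_ to _<ᶠ_)
open import Data.Fin.Subset using (Subset; _∈_; ∣_∣)
open import Data.Vec using (Vec; lookup)
open import Data.Vec.Relation.Unary.All using (All)
open import Data.Product using (Σ; ∃; _×_; _,_)
open import Data.Sum using (_⊎_)
open import Relation.Binary using (Rel; IsStrictTotalOrder)
open import Relation.Binary.PropositionalEquality using (_≡_)
open import Relation.Unary using (Pred)
open import Induction.WellFounded using (WellFounded)
open import Function.Definitions using (Injective)

record Chain : Set₁ where
  constructor mkChain
  field
    Carrier : Set
    _<_     : Rel Carrier 0ℓ

open Chain public

IsLinear : Chain → Set
IsLinear C = IsStrictTotalOrder {A = Carrier C} _≡_ (_<_ C)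

IsCountableOrdinal : Chain → Set
IsCountableOrdinal C =
  IsLinear C × WellFounded (_<_ C) × Σ (Carrier C → ℕ) (λ f → Injective _≡_ _≡_ f)

lexFin : ∀ {A : Set} (m : ℕ) → Rel A 0ℓ → Rel (Fin m × A) 0ℓ
lexFin m _<A_ (i , a) (j , b) = (i <ᶠ j) ⊎ ((i ≡ j) × (a <A b))

-- Ordinal multiplication α · m = α + ... + α (m times):
-- m consecutive copies of α, indexed by Fin m.
_·ₒ_ : Chain → ℕ → Chain
C ·ₒ m = mkChain (Fin m × Carrier C) (lexFin m (_<_ C))

IsEmb : (C : Chain) {n : ℕ} → Vec (Carrier C) n → Set
IsEmb C {n} v = ∀ (i j : Fin n) → i <ᶠ j → _<_ C (lookup v i) (lookup v j)

IsCopy : (C : Chain) → Pred (Carrier C) 0ℓ → Set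
IsCopy C U =
  Σ (Carrier C → Carrier C) λ g →
      (∀ x y → _<_ C x y → _<_ C (g x) (g y))
    × (∀ x → U (g x))
    × (∀ y → U y → ∃ λ x → g x ≡ y)

-- |χ(Emb(n,U))| ≤ t : the colours used on embeddings n ↪ U lie in a set of size ≤ t.
FewColours : (C : Chain) {n k : ℕ} → (Vec (Carrier C) n → Fin k) →
             Pred (Carrier C) 0ℓ → ℕ → Set
FewColours C {n} {k} χ U t =
  Σ (Subset k) λ S → (∣ S ∣ ≤ t) ×
    (∀ (v : Vec (Carrier C) n) → IsEmb C v → All U v → χ v ∈ S)

FiniteBRD : (C : Chain) → ℕ → Set₁
FiniteBRD C n =
  Σ ℕ λ t → ∀ (k : ℕ) → 2 ≤ k → (χ : Vec (Carrier C) n → Fin k) →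
    Σ (Pred (Carrier C) 0ℓ) λ U → IsCopy C U × FewColours C χ U t

HasFiniteBRD : Chain → Set₁
HasFiniteBRD C = ∀ (n : ℕ) → 1 ≤ n → FiniteBRD C n

{-# OPTIONS --safe #-}

-- An n-element subset of α · m is determined by a finite pattern and a finite increasing
-- tuple w in α: the pattern lists, for each point, its copy of α and the position in w of
-- its α-coordinate.  For a fixed pattern, a colouring of n-tuples of α · m becomes a
-- colouring of increasing tuples of α.  There are finitely many patterns, so successive
-- shrinking yields one self-embedding g of α that is good for all of them, and the image of
-- id × g is the required copy, with at most the sum of the bounds for the patterns as the
-- number of colours.
module Submission where

open import Defs
open import Level using (0ℓ)
open import Data.Nat using (ℕ; zero; suc; _+_; _≤_; z≤n; s≤s)
open import Data.Nat.Properties using (≤-trans; ≤-refl; ≤-reflexive; +-mono-≤; +-suc; m≤n⇒m≤1+n)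
open import Data.Bool.Base using (true; false)
open import Data.Fin as Fin using (Fin)
open import Data.Fin.Subset using (Subset; _∈_; ∣_∣; _∪_; ⊥)
open import Data.Fin.Subset.Properties using (∣⊥∣≡0; p⊆p∪q; q⊆p∪q)
open import Data.List
  using (List; []; _∷_; [_]; allFin; upTo; cartesianProduct; cartesianProductWith; concatMap)
import Data.List as List
open import Data.List.Membership.Propositional using (lose) renaming (_∈_ to _∈ˡ_)
open import Data.List.Membership.Propositional.Properties
  using (∈-allFin; ∈-upTo⁺; ∈-map⁺; ∈-cartesianProduct⁺; ∈-cartesianProductWith⁺; ∈-concatMap⁺)
open import Data.List.Relation.Unary.Any using (here; there)
open import Data.Product using (Σ; ∃; ∃-syntax; _×_; _,_; proj₂; map₂)
open import Data.Sum using (inj₁; inj₂)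
open import Data.Vec using (Vec; []; _∷_; lookup; map)
import Data.Vec.Membership.Propositional as Vec
open import Data.Vec.Properties using (map-∘; map-cong; lookup-map)
open import Data.Vec.Relation.Unary.All as All using (All; []; _∷_)
import Data.Vec.Relation.Unary.All.Properties as All
open import Data.Vec.Relation.Unary.AllPairs using (AllPairs; []; _∷_)
open import Data.Vec.Relation.Unary.Any using (here; there; index)
open import Data.Vec.Relation.Unary.Any.Properties using (lookup-index)
open import Axiom.ExcludedMiddle using (ExcludedMiddle)
open import Function using (_∘_; id)
open import Relation.Binary using (Rel; IsStrictTotalOrder; tri<; tri≈; tri>)
open import Relation.Binary.PropositionalEquality
  using (_≡_; refl; sym; trans; cong; cong₂; subst)

private
  variable
    A B : Set
    n : ℕ

∣p∪q∣≤∣p∣+∣q∣ : (p q : Subset n) → ∣ p ∪ q ∣ ≤ ∣ p ∣ + ∣ q ∣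
∣p∪q∣≤∣p∣+∣q∣ []          []          = z≤n
∣p∪q∣≤∣p∣+∣q∣ (true ∷ p)  (true ∷ q)  =
  s≤s (≤-trans (m≤n⇒m≤1+n (∣p∪q∣≤∣p∣+∣q∣ p q)) (≤-reflexive (sym (+-suc ∣ p ∣ ∣ q ∣))))
∣p∪q∣≤∣p∣+∣q∣ (true ∷ p)  (false ∷ q) = s≤s (∣p∪q∣≤∣p∣+∣q∣ p q)
∣p∪q∣≤∣p∣+∣q∣ (false ∷ p) (true ∷ q)  =
  ≤-trans (s≤s (∣p∪q∣≤∣p∣+∣q∣ p q)) (≤-reflexive (sym (+-suc ∣ p ∣ ∣ q ∣)))
∣p∪q∣≤∣p∣+∣q∣ (false ∷ p) (false ∷ q) = ∣p∪q∣≤∣p∣+∣q∣ p q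

vecsOver : List A → (n : ℕ) → List (Vec A n)
vecsOver xs zero    = [ [] ]
vecsOver xs (suc n) = cartesianProductWith _∷_ xs (vecsOver xs n)

∈-vecsOver : {xs : List A} → (∀ x → x ∈ˡ xs) → (v : Vec A n) → v ∈ˡ vecsOver xs n
∈-vecsOver all []      = here refl
∈-vecsOver all (x ∷ v) = ∈-cartesianProductWith⁺ _∷_ (all x) (∈-vecsOver all v)

-- Serves twice: to pull a tuple in the image of `map₂ g` back along it, and to read off a pattern
-- entry by entry.
map-surjectiveOn : (f : A → B) {v : Vec B n} →
  All (λ y → ∃ λ x → f x ≡ y) v → ∃ λ u → map f u ≡ v
map-surjectiveOn f []               = [] , refl
map-surjectiveOn f ((x , eq) ∷ pxs) with map-surjectiveOn f pxs
... | u , eqs = x ∷ u , cong₂ _∷_ eq eqs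

AllPairs-lookup : {R : Rel A 0ℓ} {v : Vec A n} → AllPairs R v →
  ∀ i j → i Fin.< j → R (lookup v i) (lookup v j)
AllPairs-lookup (px ∷ _)  Fin.zero    (Fin.suc j) _         = All.lookup⁺ px j
AllPairs-lookup (_ ∷ pxs) (Fin.suc i) (Fin.suc j) (s≤s i<j) = AllPairs-lookup pxs i j i<j

module Sorting {_<′_ : Rel A 0ℓ} (linear : IsStrictTotalOrder _≡_ _<′_) where
  open IsStrictTotalOrder linear using (compare) renaming (trans to <-trans)

  -- An entry equal to `x` absorbs it, so the length is only bounded. The last component strengthens
  -- the induction: when `x` moves past the head `y`, it shows that `y` stays below the whole new
  -- tail.
  insert : (x : A) (w : Vec A n) → AllPairs _<′_ w →
    ∃[ c ] c ≤ suc n × Σ (Vec A c) λ u → AllPairs _<′_ u × x Vec.∈ u ×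
      (∀ {z} → z Vec.∈ w → z Vec.∈ u) × (∀ {P : A → Set} → P x → All P w → All P u)
  insert x [] [] =
    1 , s≤s z≤n , x ∷ [] , [] ∷ [] , here refl , (λ ()) , λ px _ → px ∷ []
  insert x (y ∷ w) (y<w ∷ sorted) with compare x y
  ... | tri< x<y _ _ =
    _ , s≤s (s≤s (≤-refl)) , x ∷ y ∷ w ,
    (x<y ∷ All.map (<-trans x<y) y<w) ∷ y<w ∷ sorted ,
    here refl , there , _∷_
  ... | tri≈ _ refl _ =
    _ , m≤n⇒m≤1+n (≤-refl) , y ∷ w , y<w ∷ sorted , here refl , id , λ _ → id
  ... | tri> _ _ y<x with insert x w sorted
  ... | c , c≤ , u , u-sorted , x∈u , w⊆u , u-all =
    suc c , s≤s c≤ , y ∷ u , u-all y<x y<w ∷ u-sorted , there x∈u ,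
    (λ { (here eq) → here eq ; (there z∈w) → there (w⊆u z∈w) }) ,
    (λ { px (py ∷ pw) → py ∷ u-all px pw })

  -- Points in different copies of the chain may share a coordinate, so repetitions must be merged
  -- and `c` can be smaller than `n`.
  sort : (v : Vec A n) → ∃[ c ] c ≤ n × Σ (Vec A c) λ w →
    AllPairs _<′_ w × All (Vec._∈ w) v
  sort []      = 0 , z≤n , [] , [] , []
  sort (x ∷ v) with sort v
  ... | _ , c≤n , w , w-sorted , v⊆w with insert x w w-sorted
  ... | c , c≤ , u , u-sorted , x∈u , w⊆u , _ =
    c , ≤-trans c≤ (s≤s c≤n) , u , u-sorted , x∈u ∷ All.map w⊆u v⊆w

Increasing : (C : Chain) → (Carrier C → Carrier C) → Set
Increasing C g = ∀ x y → _<_ C x y → _<_ C (g x) (g y)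

map-isEmb : (C : Chain) {g : Carrier C → Carrier C} → Increasing C g →
  (v : Vec (Carrier C) n) → IsEmb C v → IsEmb C (map g v)
map-isEmb C {g} g↑ v emb i j i<j
  rewrite lookup-map i g v | lookup-map j g v = g↑ _ _ (emb i j i<j)

-- The arity is a successor because finite big Ramsey degrees are assumed only for nonempty tuples.
Configuration : Chain → Set → Set
Configuration C B = Σ ℕ λ c → Vec (Carrier C) (suc c) → B

-- A copy is recorded by its self-embedding rather than as a subset, so that successive shrinkings
-- compose.
GoodEmbedding : (C : Chain) → List (Configuration C B) → {k : ℕ} → (B → Fin k) → ℕ → Set
GoodEmbedding C fs {k} χ t =
  Σ (Carrier C → Carrier C) λ g → Increasing C g ×
  Σ (Subset k) λ S → ∣ S ∣ ≤ t ×
  (∀ {c f} → (c , f) ∈ˡ fs → ∀ w → IsEmb C w → χ (f (map g w)) ∈ S)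

-- Induction on the list, adding the bounds. Each bound is fixed before `k` and `χ` are known, so
-- the sum is independent of the colouring.
simultaneousBRD : (C : Chain) → HasFiniteBRD C → (fs : List (Configuration C B)) →
  Σ ℕ λ t → ∀ k → 2 ≤ k → (χ : B → Fin k) → GoodEmbedding C fs χ t
simultaneousBRD C brd [] = 0 , λ k _ _ →
  id , (λ _ _ → id) , ⊥ , ≤-reflexive (∣⊥∣≡0 k) , λ ()
simultaneousBRD C brd ((c , f) ∷ fs)
  with brd (suc c) (s≤s z≤n) | simultaneousBRD C brd fs
... | t₁ , shrink₁ | t₂ , shrink₂ = t₁ + t₂ , shrink
  where
  shrink : ∀ k → 2 ≤ k → (χ : _ → Fin k) → GoodEmbedding C ((c , f) ∷ fs) χ (t₁ + t₂)
  shrink k 2≤k χ with shrink₂ k 2≤k χ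
  -- Pulling the colouring back along `g` makes the second shrinking take place inside the image of
  -- `g`.
  ... | g , g↑ , S₂ , ∣S₂∣≤ , good₂ with shrink₁ k 2≤k (χ ∘ f ∘ map g)
  ... | U , (h , h↑ , h∈U , _) , S₁ , ∣S₁∣≤ , good₁ =
    g ∘ h , (λ x y → g↑ _ _ ∘ h↑ x y) , S₁ ∪ S₂ ,
    ≤-trans (∣p∪q∣≤∣p∣+∣q∣ S₁ S₂) (+-mono-≤ ∣S₁∣≤ ∣S₂∣≤) , good
    where
    good : ∀ {c′ f′} → (c′ , f′) ∈ˡ ((c , f) ∷ fs) →
      ∀ w → IsEmb C w → χ (f′ (map (g ∘ h) w)) ∈ S₁ ∪ S₂
    good (here refl) w emb rewrite map-∘ g h w = p⊆p∪q S₂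
      (good₁ (map h w) (map-isEmb C h↑ w emb) (All.map⁺ (All.universal h∈U w)))
    -- Earlier configurations stay good: `map h w` is again an increasing tuple, to which the
    -- property of `g` applies.
    good (there f∈)  w emb rewrite map-∘ g h w = q⊆p∪q S₁ S₂
      (good₂ f∈ (map h w) (map-isEmb C h↑ w emb))

realise : {I : Set} {c : ℕ} → Vec (I × Fin c) n → Vec A c → Vec (I × A) n
realise τ w = map (map₂ (lookup w)) τ

-- A pattern refers to `w` only through positions, so moving the coordinates by `g` leaves it
-- unchanged.
map-realise : {I : Set} {c : ℕ} (g : A → B) (τ : Vec (I × Fin c) n) (w : Vec A c) →
  map (map₂ g) (realise τ w) ≡ realise τ (map g w)
map-realise g τ w = trans (sym (map-∘ _ _ τ))
  (map-cong (λ (i , j) → cong (i ,_) (sym (lookup-map j g w))) τ)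

pattern-of : {I : Set} {c : ℕ} {w : Vec A c} (v : Vec (I × A) n) →
  All (Vec._∈ w) (map proj₂ v) → ∃ λ τ → realise τ w ≡ v
pattern-of v v⊆w = map-surjectiveOn _ (All.map
  (λ {(i , a)} a∈w → (i , index a∈w) , cong (i ,_) (sym (lookup-index a∈w)))
  (All.map⁻ v⊆w))

-- Here `c` runs below `n`, so the widths `suc c` are 1 to `n`. Patterns that realise no increasing
-- tuple are listed too; they only enlarge the finite bound.
patterns : (m n : ℕ) → List (Σ ℕ λ c → Vec (Fin m × Fin (suc c)) n)
patterns m n = concatMap
  (λ c → List.map (c ,_) (vecsOver (cartesianProduct (allFin m) (allFin (suc c))) n))
  (upTo n)

∈-patterns : ∀ {m n c} → suc c ≤ n → (τ : Vec (Fin m × Fin (suc c)) n) →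
  (c , τ) ∈ˡ patterns m n
∈-patterns c<n τ = ∈-concatMap⁺ _ (lose (∈-upTo⁺ c<n) (∈-map⁺ _
  (∈-vecsOver (λ (i , j) → ∈-cartesianProduct⁺ (∈-allFin i) (∈-allFin j)) τ)))

theorem4p4 : ExcludedMiddle 0ℓ → (α : Chain) → IsCountableOrdinal α → HasFiniteBRD α →
    (m : ℕ) → 1 ≤ m → HasFiniteBRD (α ·ₒ m)
theorem4p4 _ α (linear , _) brd m _ n@(suc _) _
  with simultaneousBRD α brd (List.map (map₂ realise) (patterns m n))
... | t , shrink = t , λ k 2≤k χ → copy k χ (shrink k 2≤k χ)
  where
  open Sorting linear

  copy : ∀ k (χ : Vec (Fin m × Carrier α) n → Fin k) →
    GoodEmbedding α (List.map (map₂ realise) (patterns m n)) χ t →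
    Σ _ λ U → IsCopy (α ·ₒ m) U × FewColours (α ·ₒ m) χ U t
  copy k χ (g , g↑ , S , ∣S∣≤t , good) =
    U , (map₂ g , G↑ , (λ x → x , refl) , λ _ → id) , S , ∣S∣≤t , few
    where
    U : Fin m × Carrier α → Set
    U y = ∃ λ x → map₂ g x ≡ y

    G↑ : Increasing (α ·ₒ m) (map₂ g)
    G↑ _ _ (inj₁ i<j)         = inj₁ i<j
    G↑ _ _ (inj₂ (i≡j , a<b)) = inj₂ (i≡j , g↑ _ _ a<b)

    few : ∀ v → IsEmb (α ·ₒ m) v → All U v → χ v ∈ S
    few v _ v∈U with map-surjectiveOn (map₂ g) v∈U
    ... | u@(_ ∷ _) , refl with sort (map proj₂ u)
    -- Since `u` is nonempty, its first coordinate cannot lie in an empty `w`.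
    ... | zero , _ , [] , _ , () ∷ _
    ... | suc c , c<n , w , w-sorted , u⊆w with pattern-of u u⊆w
    -- The pattern is that of the preimage `u`, so the given tuple is `realise τ (map g w)`, whose
    -- colour `good` controls.
    ... | τ , τ-realises-u = subst (λ v → χ v ∈ S)
      (trans (sym (map-realise g τ w)) (cong (map (map₂ g)) τ-realises-u))
      (good (∈-map⁺ (map₂ realise) (∈-patterns c<n τ)) w (AllPairs-lookup w-sorted))
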